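{- Let $\mathcal{C}$ be a simplicial complex on ground set $[m]$ and $\mathbf{d}$ an integer vector with entries $\ge2$, and assume $\mathcal{A}_{\mathcal{C},\mathbf{d}}$ is compressed. Let $v$ be a vertex of $\mathcal{C}$ and let $\mathbf{d}'$ be obtained from $\mathbf{d}$ by deleting the entry for $v$. Then $\mathcal{A}_{\mathrm{link}_v(\mathcal{C}),\mathbf{d}'}$ is compressed.
   Context: $\mathcal{A}_{\mathcal{C},\mathbf{d}}$ has columns indexed by $\mathbf{i}\in\prod_{j\in[m]}[d_j]$ and rows indexed by pairs $(F,e)$, $F$ a facet of $\mathcal{C}$, $e\in\prod_{j\in F}[d_j]$; entry $1$ if $e=(i_j:j\in F)$, else $0$. The toric ideal of a matrix $A$ with $n$ columns is $I_A=\langle x^u-x^v:u,v\in\mathbb{N}^n, Au=Av\rangle\subseteq\mathbb{K}[x_1,\dots,x_n]$. An integer matrix $A$ with homogeneous toric ideal is compressed if the initial ideal $\mathrm{in}_\prec(I_A)$ is generated by squarefree monomials for every reverse lexicographic term order $\prec$. The link is $\mathrm{link}_v(\mathcal{C})=\{F\setminus\{v\}:F\in\mathcal{C},v\in F\}$, on ground set $[m]\setminus\{v\}$. -}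

module Defs where

open import Level using (Level; _⊔_) renaming (suc to lsuc)
open import Data.Nat using (ℕ; zero; suc; _+_; _*_; _≤_; _<_)
import Data.Nat
import Data.Fin
import Data.Fin.Subset
open import Data.Fin using (Fin; zero; suc; remQuot; punchIn; _≟_)
open import Data.Fin.Properties using (all?)
open import Data.Fin.Subset using (Subset; Side; inside; outside; _⊆_)
open import Data.Fin.Permutation using (Permutation′; _⟨$⟩ʳ_)
open import Data.Vec using (lookup; insertAt)
open import Data.List using (List; foldr)
open import Data.Product using (Σ; ∃; ∃-syntax; _×_; _,_)
open import Data.Sum using (_⊎_)
open import Data.Unit using (⊤)
open import Data.Bool using (Bool; true; false; if_then_else_; _∧_)
open import Relation.Nullary using (¬_; yes; no)
open import Relation.Nullary.Decidable using (⌊_⌋)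
open import Relation.Binary.PropositionalEquality using (_≡_)
open import Algebra.Bundles using (CommutativeRing)

record Field (c ℓ : Level) : Set (lsuc (c ⊔ ℓ)) where
  field
    ring       : CommutativeRing c ℓ
  open CommutativeRing ring using (Carrier; _≈_; 0#; 1#) renaming (_*_ to _*ᴷ_)
  field
    0≉1        : ¬ (0# ≈ 1#)
    invertible : ∀ x → ¬ (x ≈ 0#) → ∃[ y ] (x *ᴷ y ≈ 1#)

Exp : ℕ → Set
Exp n = Fin n → ℕ

_⊕_ : ∀ {n} → Exp n → Exp n → Exp n
(u ⊕ v) i = u i + v i

sumFin : ∀ n → (Fin n → ℕ) → ℕ
sumFin zero    f = 0
sumFin (suc n) f = f zero + sumFin n (λ i → f (suc i))

deg : ∀ {n} → Exp n → ℕ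
deg {n} u = sumFin n u

_≼_ : ∀ {n} → Exp n → Exp n → Set
u ≼ v = ∀ i → u i ≤ v i

Squarefree : ∀ {n} → Exp n → Set
Squarefree u = ∀ i → u i ≤ 1

_≟Exp_ : ∀ {n} → Exp n → Exp n → Bool
u ≟Exp v = ⌊ all? (λ i → Data.Nat._≟_ (u i) (v i)) ⌋

Matrix : Set → ℕ → Set
Matrix R n = R → Fin n → ℕ

_·_ : ∀ {R n} → Matrix R n → Exp n → R → ℕ
_·_ {n = n} A u ρ = sumFin n (λ i → A ρ i * u i)

SameFiber : ∀ {R n} → Matrix R n → Exp n → Exp n → Set
SameFiber A u v = ∀ ρ → (A · u) ρ ≡ (A · v) ρ

-- I_A is homogeneous (w.r.t. standard grading): all generators x^u - x^v
-- are homogeneous.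
Homogeneous : ∀ {R n} → Matrix R n → Set
Homogeneous A = ∀ u v → SameFiber A u v → deg u ≡ deg v

-- Reverse lexicographic term orders.  A permutation σ fixes the variable
-- order x_{σ 0} > x_{σ 1} > ... > x_{σ (n-1)}.  Then x^u ≻ x^v iff
-- deg u > deg v, or deg u = deg v and, at the last variable (in this
-- order) where u and v differ, u has the smaller exponent.

RevLexGt : ∀ {n} → Permutation′ n → Exp n → Exp n → Set
RevLexGt {n} σ u v =
  deg v < deg u ⊎
  (deg u ≡ deg v ×
   ∃[ k ] (u (σ ⟨$⟩ʳ k) < v (σ ⟨$⟩ʳ k) ×
           (∀ l → Data.Fin._<_ k l → u (σ ⟨$⟩ʳ l) ≡ v (σ ⟨$⟩ʳ l))))

-- Elements of the toric ideal I_A ⊆ K[x_1..x_n]: by definition I_A is the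
-- ideal generated by binomials x^u - x^v with A u = A v, so its elements
-- are exactly finite sums Σ_k c_k x^{w_k} (x^{u_k} - x^{v_k}).

module Toric {c ℓ} (K : Field c ℓ) where
  open Field K using (ring)
  open CommutativeRing ring using (Carrier; _≈_; 0#) renaming (_+_ to _+ᴷ_; _-_ to _-ᴷ_)

  record BinTerm {R : Set} {n : ℕ} (A : Matrix R n) : Set c where
    field
      coef : Carrier
      w u v : Exp n
      fib  : SameFiber A u v

  coeff : ∀ {R n} {A : Matrix R n} → List (BinTerm A) → Exp n → Carrier
  coeff L α = foldr (λ t acc →
      let open BinTerm t in
      ((if (w ⊕ u) ≟Exp α then coef else 0#) -ᴷ
       (if (w ⊕ v) ≟Exp α then coef else 0#)) +ᴷ acc) 0# L

  LeadingMonomial : ∀ {R n} → Matrix R n → Permutation′ n → Exp n → Set (c ⊔ ℓ)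
  LeadingMonomial A σ α =
    ∃[ f ] (¬ (coeff {A = A} f α ≈ 0#) ×
            (∀ β → RevLexGt σ β α → coeff {A = A} f β ≈ 0#))

  InInitial : ∀ {R n} → Matrix R n → Permutation′ n → Exp n → Set (c ⊔ ℓ)
  InInitial A σ γ = ∃[ α ] (LeadingMonomial A σ α × α ≼ γ)

  -- in_≺(I_A) is generated by squarefree monomials: every monomial of it
  -- is divisible by a squarefree monomial of it.
  SquarefreeInitial : ∀ {R n} → Matrix R n → Permutation′ n → Set (c ⊔ ℓ)
  SquarefreeInitial A σ =
    ∀ γ → InInitial A σ γ → ∃[ s ] (Squarefree s × InInitial A σ s × s ≼ γ)

  Compressed : ∀ {R n} → Matrix R n → Set (c ⊔ ℓ)
  Compressed A = Homogeneous A × (∀ σ → SquarefreeInitial A σ)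

Complex : ℕ → Set₁
Complex m = Subset m → Set

IsSimplicialComplex : ∀ {m} → Complex m → Set
IsSimplicialComplex C = ∀ F G → G ⊆ F → C F → C G

IsFacet : ∀ {m} → Complex m → Subset m → Set
IsFacet C F = C F × (∀ G → C G → F ⊆ G → G ⊆ F)

singleton : ∀ {m} → Fin m → Subset m
singleton = Data.Fin.Subset.⁅_⁆

IsVertex : ∀ {m} → Complex m → Fin m → Set
IsVertex C v = C (singleton v)

-- link_v(C) on ground set [m] ∖ {v} ≅ Fin m' (via punchIn v):
-- G is a face iff G ∪ {v} ∈ C.
link : ∀ {m} → Complex (suc m) → Fin (suc m) → Complex m
link C v G = C (insertAt G v inside)

deleteEntry : ∀ {m} → (Fin (suc m) → ℕ) → Fin (suc m) → (Fin m → ℕ)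
deleteEntry d v j = d (punchIn v j)

prodFin : ∀ m → (Fin m → ℕ) → ℕ
prodFin zero    d = 1
prodFin (suc m) d = d zero * prodFin m (λ j → d (suc j))

-- columns: Fin (∏ d_j) enumerates ∏_{j∈[m]} [d_j] (mixed radix, bijective)
decodeCol : ∀ m (d : Fin m → ℕ) → Fin (prodFin m d) → (j : Fin m) → Fin (d j)
decodeCol zero    d k ()
decodeCol (suc m) d k j with remQuot {d zero} (prodFin m (λ j → d (suc j))) k
decodeCol (suc m) d k zero    | a , b = a
decodeCol (suc m) d k (suc j) | a , b = decodeCol m (λ j → d (suc j)) b j

-- ∏_{j∈F} [d_j], coordinates outside F are trivial
Coord : ∀ {m} → (Fin m → ℕ) → Subset m → Fin m → Set
Coord d F j with lookup F j
... | inside  = Fin (d j)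
... | outside = ⊤

Row : ∀ {m} → Complex m → (Fin m → ℕ) → Set
Row {m} C d = Σ (Subset m) λ F → IsFacet C F × ((j : Fin m) → Coord d F j)

agreeAt : ∀ {m} (d : Fin m → ℕ) (F : Subset m) → (e : (j : Fin m) → Coord d F j) →
          ((j : Fin m) → Fin (d j)) → (j : Fin m) → Bool
agreeAt d F e i j with lookup F j | e j
... | inside  | ej = ⌊ ej ≟ i j ⌋
... | outside | _  = true

allFin : ∀ m → (Fin m → Bool) → Bool
allFin zero    f = true
allFin (suc m) f = f zero ∧ allFin m (λ j → f (suc j))

A[_,_] : ∀ {m} → (C : Complex m) → (d : Fin m → ℕ) → Matrix (Row C d) (prodFin m d)
A[_,_] {m} C d (F , _ , e) k =
  if allFin m (agreeAt d F e (decodeCol m d k)) then 1 else 0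

{-# OPTIONS --safe #-}
-- Sums over terms of a list are grouped along the connected components of the graph joining the
-- two monomials of each term: in a component the coefficients cancel, so a leading monomial α of
-- I_A always comes with a binomial x^α - x^β in I_A, α ≻ β.  Given such a binomial for the link,
-- copy α and β to two slices a, b of the columns of A_C along v: the exponent (α on a, β on b) is
-- in the same fiber as (β on a, α on b), and it is the leading one when slice a carries the
-- cheapest variables.  A squarefree leading monomial s dividing it belongs to a binomial
-- x^s - x^t; all slices of s and t lie in common fibers of the link.  At the slice c where s and
-- t differ last, either c = a, and the slice of s is a squarefree divisor of α, or c = b, and β
-- can be replaced by a smaller monomial of its fiber; on any other slice s, hence t, vanishes.
module Submission where

open import Defs
open import Level using (Level)
open import Algebra.Bundles using (CommutativeRing)
import Algebra.Properties.CommutativeMonoid.Sum as MonoidSum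
open import Data.Bool using (Bool; true; false; if_then_else_; _∧_; not)
open import Data.Bool.Properties using (∧-assoc; ∧-comm; ∧-zeroʳ)
import Data.Empty as Empty
open import Data.Fin using (Fin; zero; suc; combine; remQuot; punchIn; punchOut; _≟_; _↑ˡ_; _↑ʳ_; toℕ; cast; fromℕ)
  renaming (_<_ to _<ᶠ_)
open import Data.Fin.Permutation as Perm
  using (Permutation; Permutation′; _⟨$⟩ʳ_; _⟨$⟩ˡ_; inverseˡ; inverseʳ; _∘ₚ_; ↔⇒≡)
open import Data.Fin.Properties
  using (all?; toℕ-cast; toℕ-combine; toℕ-injective; combine-surjective; combine-remQuot; remQuot-combine;
         combine-monoˡ-<; ≤fromℕ; punchIn-punchOut)
open import Data.Fin.Subset using (Subset; inside; outside; _⊆_; _⊃_; ⊥; ⁅_⁆)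
open import Data.Fin.Subset.Induction using (⊃-wellFounded; Acc; acc)
open import Data.Fin.Subset.Properties using (_∈?_)
open import Data.List using (List; []; _∷_)
open import Data.List.Relation.Unary.All as All using (All; []; _∷_)
open import Data.List.Relation.Unary.Any using (Any; here; there)
open import Data.Nat using (ℕ; zero; suc; _+_; _*_; _∸_; _^_; _≤_; _<_; z≤n; s≤s)
import Data.Nat as ℕ
open import Data.Nat.Properties
  using (+-0-commutativeMonoid; +-identityʳ; +-assoc; +-comm; +-suc; *-zeroʳ; *-suc; *-distribˡ-+; *-assoc;
         *-comm; *-identityˡ; m≤m+n; m≤n+m; m∸n+n≡m; ≤-trans; ≤-refl; ≤-reflexive; <⇒≱; <-trans; <-asym;
         <-irrefl; <-cmp; n≮0; +-monoˡ-<; +-monoʳ-<; +-monoˡ-≤; +-cancelˡ-<; *-monoʳ-≤; module ≤-Reasoning)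
open import Data.Product using (∃; ∃₂; ∃-syntax; _×_; _,_; proj₁; proj₂)
open import Data.Sum using (_⊎_; inj₁; inj₂)
open import Data.Unit using (tt)
open import Data.Vec using (lookup; insertAt; removeAt; _∷_)
open import Data.Vec.Properties
  using (insertAt-lookup; insertAt-punchIn; insertAt-removeAt; []=⇒lookup; lookup⇒[]=)
open import Function using (_∘_)
open import Relation.Binary.Definitions using (tri<; tri≈; tri>)
open import Relation.Binary.PropositionalEquality
  using (_≡_; _≢_; refl; sym; trans; cong; cong₂; subst; subst₂; module ≡-Reasoning)
open import Relation.Nullary using (¬_; yes; no; contradiction)
open import Relation.Nullary.Decidable using (⌊_⌋; decidable-stable)

-- Finite sums of natural numbers

private
  module ℕΣ = MonoidSum +-0-commutativeMonoid

infix 4 _≐_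
-- Exponents are functions, so pointwise agreement stands in for propositional equality; every test
-- on exponents is then shown to respect it.
_≐_ : ∀ {n} → Exp n → Exp n → Set
u ≐ v = ∀ i → u i ≡ v i

ind : Bool → ℕ
ind b = if b then 1 else 0

δ : ∀ {p} → Fin p → Fin p → ℕ
δ a c = ind ⌊ a ≟ c ⌋

sumFin≡sum : ∀ n (f : Fin n → ℕ) → sumFin n f ≡ ℕΣ.sum f
sumFin≡sum zero    f = refl
sumFin≡sum (suc n) f = cong (f zero +_) (sumFin≡sum n (f ∘ suc))

sumFin-cong : ∀ n {f g : Fin n → ℕ} → f ≐ g → sumFin n f ≡ sumFin n g
sumFin-cong zero    e = refl
sumFin-cong (suc n) e = cong₂ _+_ (e zero) (sumFin-cong n (e ∘ suc))

sumFin-0 : ∀ n {f : Fin n → ℕ} → (∀ i → f i ≡ 0) → sumFin n f ≡ 0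
sumFin-0 zero    e = refl
sumFin-0 (suc n) e = cong₂ _+_ (e zero) (sumFin-0 n (e ∘ suc))

sumFin-+ : ∀ n (f g : Fin n → ℕ) → sumFin n (λ i → f i + g i) ≡ sumFin n f + sumFin n g
sumFin-+ n f g = begin
  sumFin n (λ i → f i + g i)    ≡⟨ sumFin≡sum n _ ⟩
  ℕΣ.sum (λ i → f i + g i)      ≡⟨ ℕΣ.∑-distrib-+ f g ⟩
  ℕΣ.sum f + ℕΣ.sum g           ≡⟨ cong₂ _+_ (sumFin≡sum n f) (sumFin≡sum n g) ⟨
  sumFin n f + sumFin n g       ∎
  where open ≡-Reasoning

sumFin-*ˡ : ∀ n c (f : Fin n → ℕ) → sumFin n (λ i → c * f i) ≡ c * sumFin n f
sumFin-*ˡ zero    c f = sym (*-zeroʳ c)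
sumFin-*ˡ (suc n) c f = trans (cong (c * f zero +_) (sumFin-*ˡ n c (f ∘ suc)))
                              (sym (*-distribˡ-+ c (f zero) _))

sumFin-swap : ∀ m n (f : Fin m → Fin n → ℕ) →
              sumFin m (λ i → sumFin n (f i)) ≡ sumFin n (λ j → sumFin m (λ i → f i j))
sumFin-swap zero    n f = sym (sumFin-0 n (λ _ → refl))
sumFin-swap (suc m) n f = trans (cong (sumFin n (f zero) +_) (sumFin-swap m n (f ∘ suc)))
                                (sym (sumFin-+ n (f zero) _))

sumFin-permute : ∀ {m n} (f : Fin n → ℕ) (π : Permutation m n) →
                 sumFin n f ≡ sumFin m (λ i → f (π ⟨$⟩ʳ i))
sumFin-permute {m} {n} f π =
  trans (sumFin≡sum n f) (trans (ℕΣ.sum-permute f π) (sym (sumFin≡sum m _)))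

sumFin-δ : ∀ p (a : Fin p) (f : Fin p → ℕ) → sumFin p (λ c → δ a c * f c) ≡ f a
sumFin-δ (suc p) zero    f = trans (cong₂ _+_ (+-identityʳ (f zero)) (sumFin-0 p (λ _ → refl)))
                                   (+-identityʳ (f zero))
sumFin-δ (suc p) (suc a) f =
  trans (sumFin-cong p (λ c → cong (_* f (suc c)) (δ-suc c))) (sumFin-δ p a (f ∘ suc))
  where
  δ-suc : ∀ c → δ (suc a) (suc c) ≡ δ a c
  δ-suc c with a ≟ c
  ... | yes _ = refl
  ... | no  _ = refl

sumFin-↑ : ∀ m n (f : Fin (m + n) → ℕ) →
           sumFin (m + n) f ≡ sumFin m (λ i → f (i ↑ˡ n)) + sumFin n (λ j → f (m ↑ʳ j))
sumFin-↑ zero    n f = refl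
sumFin-↑ (suc m) n f = trans (cong (f zero +_) (sumFin-↑ m n (f ∘ suc))) (sym (+-assoc (f zero) _ _))

sumFin-combine : ∀ p n (f : Fin (p * n) → ℕ) →
                 sumFin (p * n) f ≡ sumFin p (λ c → sumFin n (λ k → f (combine c k)))
sumFin-combine zero    n f = refl
sumFin-combine (suc p) n f =
  trans (sumFin-↑ n (p * n) f) (cong₂ _+_ refl (sumFin-combine p n (λ j → f (n ↑ʳ j))))

term≤sumFin : ∀ n (f : Fin n → ℕ) i → f i ≤ sumFin n f
term≤sumFin (suc n) f zero    = m≤m+n _ _
term≤sumFin (suc n) f (suc i) = ≤-trans (term≤sumFin n (f ∘ suc) i) (m≤n+m _ _)

-- Exponent vectors and reverse lexicographic orders

·-cong : ∀ {R n} (A : Matrix R n) {u v : Exp n} → u ≐ v → SameFiber A u v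
·-cong {n = n} A e ρ = sumFin-cong n (λ i → cong (A ρ i *_) (e i))

·-⊕ : ∀ {R n} (A : Matrix R n) (u v : Exp n) ρ → (A · (u ⊕ v)) ρ ≡ (A · u) ρ + (A · v) ρ
·-⊕ {n = n} A u v ρ = trans (sumFin-cong n (λ i → *-distribˡ-+ (A ρ i) (u i) (v i))) (sumFin-+ n _ _)

SameFiber-trans : ∀ {R n} (A : Matrix R n) {u v w : Exp n} →
                  SameFiber A u v → SameFiber A v w → SameFiber A u w
SameFiber-trans A p q ρ = trans (p ρ) (q ρ)

SameFiber-sym : ∀ {R n} (A : Matrix R n) {u v : Exp n} → SameFiber A u v → SameFiber A v u
SameFiber-sym A p ρ = sym (p ρ)

SameFiber-⊕ : ∀ {R n} (A : Matrix R n) (w : Exp n) {u v : Exp n} →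
              SameFiber A u v → SameFiber A (w ⊕ u) (w ⊕ v)
SameFiber-⊕ A w {u} {v} p ρ =
  trans (·-⊕ A w u ρ) (trans (cong ((A · w) ρ +_) (p ρ)) (sym (·-⊕ A w v ρ)))

≟Exp-sound : ∀ {n} (u v : Exp n) → (u ≟Exp v) ≡ true → u ≐ v
≟Exp-sound u v e with all? (λ i → ℕ._≟_ (u i) (v i))
... | yes p = p
≟Exp-sound u v () | no _

≟Exp-complete : ∀ {n} {u v : Exp n} → u ≐ v → (u ≟Exp v) ≡ true
≟Exp-complete {u = u} {v} e with all? (λ i → ℕ._≟_ (u i) (v i))
... | yes _ = refl
... | no ¬p = contradiction e ¬p

≟Exp-false : ∀ {n} {u v : Exp n} → ¬ (u ≐ v) → (u ≟Exp v) ≡ false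
≟Exp-false {u = u} {v} ne with all? (λ i → ℕ._≟_ (u i) (v i))
... | yes p = contradiction p ne
... | no _  = refl

≟Exp-congˡ : ∀ {n} {u u′ : Exp n} (v : Exp n) → u ≐ u′ → (u ≟Exp v) ≡ (u′ ≟Exp v)
≟Exp-congˡ {u = u} {u′} v e with all? (λ i → ℕ._≟_ (u i) (v i))
... | yes p = sym (≟Exp-complete (λ i → trans (sym (e i)) (p i)))
... | no ¬p = sym (≟Exp-false (λ q → ¬p (λ i → trans (e i) (q i))))

lastDifference : ∀ n (f g : Exp n) →
  f ≐ g ⊎ ∃[ k ] (f k ≢ g k × (∀ l → k <ᶠ l → f l ≡ g l))
lastDifference zero    f g = inj₁ (λ ())
lastDifference (suc n) f g with lastDifference n (f ∘ suc) (g ∘ suc)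
... | inj₂ (k , ne , above) = inj₂ (suc k , ne , λ { (suc l) (s≤s k<l) → above l k<l })
... | inj₁ e with ℕ._≟_ (f zero) (g zero)
...   | yes e₀ = inj₁ (λ { zero → e₀ ; (suc i) → e i })
...   | no ne  = inj₂ (zero , ne , λ { (suc l) _ → e l })

module _ {n : ℕ} (σ : Permutation′ n) where

  RevLexGt-irrefl : ∀ {u v} → u ≐ v → ¬ RevLexGt σ u v
  RevLexGt-irrefl e (inj₁ lt)                = <-irrefl (sumFin-cong n (sym ∘ e)) lt
  RevLexGt-irrefl e (inj₂ (_ , k , lt , _)) = <-irrefl (e _) lt

  RevLexGt-trans : ∀ {u v w} → RevLexGt σ u v → RevLexGt σ v w → RevLexGt σ u w
  RevLexGt-trans (inj₁ p)       (inj₁ q)       = inj₁ (<-trans q p)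
  RevLexGt-trans (inj₁ p)       (inj₂ (e , _)) = inj₁ (subst (_< _) e p)
  RevLexGt-trans (inj₂ (e , _)) (inj₁ q)       = inj₁ (subst (_ <_) (sym e) q)
  RevLexGt-trans (inj₂ (e , k , lt , above)) (inj₂ (e′ , k′ , lt′ , above′))
    with <-cmp (toℕ k) (toℕ k′)
  ... | tri< k<k′ _ _ = inj₂ (trans e e′ , k′ , subst (_< _) (sym (above k′ k<k′)) lt′ ,
                              λ l h → trans (above l (<-trans k<k′ h)) (above′ l h))
  ... | tri> _ _ k′<k = inj₂ (trans e e′ , k , subst (_ <_) (above′ k k′<k) lt ,
                              λ l h → trans (above l h) (above′ l (<-trans k′<k h)))
  ... | tri≈ _ k≡k′ _ with toℕ-injective k≡k′
  ...   | refl = inj₂ (trans e e′ , k , <-trans lt lt′ , λ l h → trans (above l h) (above′ l h))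

  RevLexGt-respʳ : ∀ {u v w} → v ≐ w → RevLexGt σ u v → RevLexGt σ u w
  RevLexGt-respʳ e (inj₁ lt) = inj₁ (subst (_< _) (sumFin-cong n e) lt)
  RevLexGt-respʳ e (inj₂ (eq , k , lt , above)) =
    inj₂ (trans eq (sumFin-cong n e) , k , subst (_ <_) (e _) lt , λ l h → trans (above l h) (e _))

  RevLexGt-compare : ∀ u v → RevLexGt σ u v ⊎ u ≐ v ⊎ RevLexGt σ v u
  RevLexGt-compare u v with <-cmp (deg u) (deg v)
  ... | tri< lt _ _ = inj₂ (inj₂ (inj₁ lt))
  ... | tri> _ _ gt = inj₁ (inj₁ gt)
  ... | tri≈ _ e _ with lastDifference n (u ∘ (σ ⟨$⟩ʳ_)) (v ∘ (σ ⟨$⟩ʳ_))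
  ...   | inj₁ same = inj₂ (inj₁ (λ i → subst (λ z → u z ≡ v z) (inverseʳ σ) (same (σ ⟨$⟩ˡ i))))
  ...   | inj₂ (k , ne , above) with <-cmp (u (σ ⟨$⟩ʳ k)) (v (σ ⟨$⟩ʳ k))
  ...     | tri< lt _ _ = inj₁ (inj₂ (e , k , lt , above))
  ...     | tri≈ _ eq _ = contradiction eq ne
  ...     | tri> _ _ gt = inj₂ (inj₂ (inj₂ (sym e , k , gt , λ l h → sym (above l h))))

-- Little-endian digits: the last difference, which decides the revlex order, decides the value.
value : ∀ {n} → ℕ → Exp n → ℕ
value {zero}  B u = 0
value {suc n} B u = u zero + B * value B (u ∘ suc)

-- Carrying step shared by `value-<` and `value-bound`: a digit below `B` cannot make up for a gap
-- of one in the higher digits.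
digits-< : ∀ {x B y z} w → x < B → y < z → x + B * y < w + B * z
digits-< {x} {B} {y} {z} w x<B y<z = begin-strict
  x + B * y   <⟨ +-monoˡ-< (B * y) x<B ⟩
  B + B * y   ≡⟨ *-suc B y ⟨
  B * suc y   ≤⟨ *-monoʳ-≤ B y<z ⟩
  B * z       ≤⟨ m≤n+m (B * z) w ⟩
  w + B * z   ∎
  where open ≤-Reasoning

-- The bound is on `u`: below the deciding place the worst case is `u` with full digits against `v`
-- with zeros.
value-< : ∀ {n} B (u v : Exp n) → (∀ i → u i < B) → ∀ k → u k < v k →
          (∀ l → k <ᶠ l → u l ≡ v l) → value B u < value B v
value-< {suc n} B u v bd zero    lt above =
  subst (λ z → u zero + B * value B (u ∘ suc) < v zero + B * z)
        (value-cong (λ i → above (suc i) (s≤s z≤n))) (+-monoˡ-< _ lt)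
  where
  value-cong : ∀ {n} {u v : Exp n} → u ≐ v → value B u ≡ value B v
  value-cong {zero}  e = refl
  value-cong {suc n} e = cong₂ (λ x y → x + B * y) (e zero) (value-cong (e ∘ suc))
value-< {suc n} B u v bd (suc k) lt above =
  digits-< (v zero) (bd zero)
    (value-< B (u ∘ suc) (v ∘ suc) (bd ∘ suc) k lt (λ l h → above (suc l) (s≤s h)))

value-bound : ∀ {n} B (u : Exp n) → (∀ i → u i < B) → value B u < B ^ n
value-bound {zero}  B u bd = s≤s z≤n
value-bound {suc n} B u bd = digits-< 0 (bd zero) (value-bound B (u ∘ suc) (bd ∘ suc))

-- Leading monomials and binomials

module Initial {c ℓ} (K : Field c ℓ) {R : Set} {n : ℕ} (A : Matrix R n) where
  open Toric K
  open Field K using (ring; 0≉1)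
  open CommutativeRing ring
    using (Carrier; _≈_; 0#; 1#; setoid; -‿cong; -‿inverseʳ; +-commutativeMonoid)
    renaming (_+_ to _+ᴷ_; _-_ to _-ᴷ_; -_ to -ᴷ_; refl to ≈-refl; sym to ≈-sym; trans to ≈-trans;
              +-cong to +ᴷ-cong; +-identityˡ to +ᴷ-identityˡ; +-identityʳ to +ᴷ-identityʳ)
  open import Algebra.Solver.CommutativeMonoid +-commutativeMonoid using (solve; _⊜_) renaming (_⊕_ to _:+_)
  open import Algebra.Properties.AbelianGroup (CommutativeRing.+-abelianGroup ring) using (⁻¹-∙-comm; ε⁻¹≈ε)
  open import Relation.Binary.Reasoning.Setoid setoid

  Term : Set c
  Term = BinTerm A

  head tail : Term → Exp n
  head t = BinTerm.w t ⊕ BinTerm.u t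
  tail t = BinTerm.w t ⊕ BinTerm.v t

  head~tail : ∀ t → SameFiber A (head t) (tail t)
  head~tail t = SameFiber-⊕ A (BinTerm.w t) (BinTerm.fib t)

  [_]_ : Bool → Carrier → Carrier
  [ b ] x = if b then x else 0#

  -- The sum of the coefficients of the monomials selected by b.
  Φ : (Exp n → Bool) → List Term → Carrier
  Φ b []      = 0#
  Φ b (t ∷ L) = (([ b (head t) ] BinTerm.coef t) -ᴷ ([ b (tail t) ] BinTerm.coef t)) +ᴷ Φ b L

  coeff≈Φ : ∀ L α → coeff L α ≈ Φ (_≟Exp α) L
  coeff≈Φ []      α = ≈-refl
  coeff≈Φ (t ∷ L) α = +ᴷ-cong ≈-refl (coeff≈Φ L α)

  Φ-cong : ∀ {b b′} L → (∀ x → b x ≡ b′ x) → Φ b L ≈ Φ b′ L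
  Φ-cong []      e = ≈-refl
  Φ-cong (t ∷ L) e rewrite e (head t) | e (tail t) = +ᴷ-cong ≈-refl (Φ-cong L e)

  -- A term with both monomials selected contributes its coefficient and its negative; a term with
  -- neither contributes nothing.
  Φ-balanced : ∀ {b L} → All (λ t → b (head t) ≡ b (tail t)) L → Φ b L ≈ 0#
  Φ-balanced []       = ≈-refl
  Φ-balanced {b} {t ∷ L} (e ∷ es) rewrite e =
    ≈-trans (+ᴷ-cong (-‿inverseʳ _) (Φ-balanced es)) (+ᴷ-identityˡ 0#)

  Φ-split : ∀ (b e : Exp n → Bool) L → Φ b L ≈ Φ (λ x → b x ∧ e x) L +ᴷ Φ (λ x → b x ∧ not (e x)) L
  Φ-split b e []      = ≈-sym (+ᴷ-identityˡ 0#)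
  Φ-split b e (t ∷ L) = begin
    ((p -ᴷ q) +ᴷ Φ b L)
      ≈⟨ +ᴷ-cong (+ᴷ-cong (split (b (head t)) (e (head t)))
                        (-‿cong (split (b (tail t)) (e (tail t))))) (Φ-split b e L) ⟩
    ((p₁ +ᴷ p₂) -ᴷ (q₁ +ᴷ q₂)) +ᴷ (r₁ +ᴷ r₂)
      ≈⟨ +ᴷ-cong (+ᴷ-cong ≈-refl (≈-sym (⁻¹-∙-comm q₁ q₂))) ≈-refl ⟩
    ((p₁ +ᴷ p₂) +ᴷ ((-ᴷ q₁) +ᴷ (-ᴷ q₂))) +ᴷ (r₁ +ᴷ r₂)
      ≈⟨ solve 6 (λ a b c d e f → (((a :+ b) :+ (c :+ d)) :+ (e :+ f)) ⊜ (((a :+ c) :+ e) :+ ((b :+ d) :+ f)))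
               ≈-refl p₁ p₂ (-ᴷ q₁) (-ᴷ q₂) r₁ r₂ ⟩
    ((p₁ -ᴷ q₁) +ᴷ r₁) +ᴷ ((p₂ -ᴷ q₂) +ᴷ r₂) ∎
    where
    x = BinTerm.coef t
    p = [ b (head t) ] x
    q = [ b (tail t) ] x
    p₁ = [ b (head t) ∧ e (head t) ] x
    p₂ = [ b (head t) ∧ not (e (head t)) ] x
    q₁ = [ b (tail t) ∧ e (tail t) ] x
    q₂ = [ b (tail t) ∧ not (e (tail t)) ] x
    r₁ = Φ (λ x → b x ∧ e x) L
    r₂ = Φ (λ x → b x ∧ not (e x)) L
    split : ∀ b e → [ b ] x ≈ ([ b ∧ e ] x) +ᴷ ([ b ∧ not e ] x)
    split false _     = ≈-sym (+ᴷ-identityˡ 0#)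
    split true  false = ≈-sym (+ᴷ-identityˡ x)
    split true  true  = ≈-sym (+ᴷ-identityʳ x)

  Respects≐ : (Exp n → Bool) → Set
  Respects≐ b = ∀ {x y} → x ≐ y → b x ≡ b y

  ∧-≟Exp-true : ∀ {b s} → Respects≐ b → b s ≡ true → ∀ x → (b x ∧ (x ≟Exp s)) ≡ (x ≟Exp s)
  ∧-≟Exp-true {b} {s} resp bs x with x ≟Exp s in eq
  ... | false = ∧-zeroʳ (b x)
  ... | true rewrite resp (≟Exp-sound x s eq) | bs = refl

  ∧-≟Exp-false : ∀ {b s} → Respects≐ b → b s ≡ false → ∀ x → (b x ∧ (x ≟Exp s)) ≡ false
  ∧-≟Exp-false {b} {s} resp bs x with x ≟Exp s in eq
  ... | false = ∧-zeroʳ (b x)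
  ... | true rewrite resp (≟Exp-sound x s eq) | bs = refl

  Covers : (Exp n → Bool) → List (Exp n) → Exp n → Set
  Covers b S x = b x ≡ true → Any (x ≐_) S

  -- Each step of the induction on `S` splits off the selected monomials equal to `s`, whose sum is
  -- the coefficient at `s`. The remaining selection excludes `s`, so repetitions in `S` are
  -- harmless, and once `S` is exhausted no monomial of `L` is selected.
  Φ-vanish : ∀ S {b} L → Respects≐ b →
             All (λ t → Covers b S (head t) × Covers b S (tail t)) L →
             All (λ x → b x ≡ true → coeff L x ≈ 0#) S → Φ b L ≈ 0#
  Φ-vanish [] {b} L resp cov _ =
    Φ-balanced (All.map (λ (h , t) → trans (none h) (sym (none t))) cov)
    where
    none : ∀ {x} → Covers b [] x → b x ≡ false
    none {x} h with b x
    ... | false = refl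
    ... | true with () ← h refl
  Φ-vanish (s ∷ S) {b} L resp cov (z ∷ zs) = begin
    Φ b L                                           ≈⟨ Φ-split b (_≟Exp s) L ⟩
    Φ (λ x → b x ∧ (x ≟Exp s)) L +ᴷ Φ b′ L          ≈⟨ +ᴷ-cong at-s rest ⟩
    0# +ᴷ 0#                                        ≈⟨ +ᴷ-identityˡ 0# ⟩
    0#                                              ∎
    where
    b′ : Exp n → Bool
    b′ x = b x ∧ not (x ≟Exp s)
    at-s : Φ (λ x → b x ∧ (x ≟Exp s)) L ≈ 0#
    at-s with b s in eq
    ... | true  = ≈-trans (Φ-cong L (∧-≟Exp-true resp eq)) (≈-trans (≈-sym (coeff≈Φ L s)) (z refl))
    ... | false = ≈-trans (Φ-cong L (∧-≟Exp-false resp eq)) (Φ-balanced (All.universal (λ _ → refl) L))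
    cov′ : ∀ {x} → Covers b (s ∷ S) x → Covers b′ S x
    cov′ {x} h e with b x | x ≟Exp s in eq
    cov′ {x} h () | false | _
    cov′ {x} h () | true  | true
    cov′ {x} h e  | true  | false with h refl
    ... | there a = a
    ... | here x≐s = contradiction (trans (sym eq) (≟Exp-complete x≐s)) λ ()
    weaken : ∀ {x} → b′ x ≡ true → b x ≡ true
    weaken {x} e with b x
    ... | true = refl
    weaken {x} () | false
    rest : Φ b′ L ≈ 0#
    rest = Φ-vanish S L (λ e → cong₂ (λ p q → p ∧ not q) (resp e) (≟Exp-congˡ s e))
                    (All.map (λ (h , t) → cov′ h , cov′ t) cov)
                    (All.map (λ {x} f e → f (weaken {x} e)) zs)

  -- rep L picks a representative in each connected component of the graph on exponents whose
  -- edges join the two monomials of each term of L.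
  rep : List Term → Exp n → Exp n
  rep []      x = x
  rep (t ∷ L) x = if rep L x ≟Exp rep L (head t) then rep L (tail t) else rep L x

  -- Components lie inside fibers, because each redirection follows an edge whose two ends have the
  -- same image under `A`.
  rep-fiber : ∀ L x → SameFiber A x (rep L x)
  rep-fiber []      x = λ _ → refl
  rep-fiber (t ∷ L) x with rep L x ≟Exp rep L (head t) in eq
  ... | false = rep-fiber L x
  ... | true  = λ ρ → trans (rep-fiber L x ρ) (trans (·-cong A (≟Exp-sound _ _ eq) ρ)
                  (trans (sym (rep-fiber L (head t) ρ)) (trans (head~tail t ρ) (rep-fiber L (tail t) ρ))))

  -- A further term only merges components: monomials once identified stay identified.
  rep-step : ∀ t L {x y} → rep L x ≐ rep L y → rep (t ∷ L) x ≐ rep (t ∷ L) y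
  rep-step t L {x} {y} e rewrite ≟Exp-congˡ (rep L (head t)) e with rep L y ≟Exp rep L (head t)
  ... | true  = λ _ → refl
  ... | false = e

  rep-cong : ∀ L {x y} → x ≐ y → rep L x ≐ rep L y
  rep-cong []      e = e
  rep-cong (t ∷ L) {x} {y} e = rep-step t L {x} {y} (rep-cong L e)

  rep-edges : ∀ L → All (λ t → rep L (head t) ≐ rep L (tail t)) L
  rep-edges []      = []
  rep-edges (t ∷ L) = here′ ∷ All.map (λ {t′} → rep-step t L {head t′} {tail t′}) (rep-edges L)
    where
    here′ : rep (t ∷ L) (head t) ≐ rep (t ∷ L) (tail t)
    -- The component of the head is redirected to `rep L (tail t)`. The tail either lay in that
    -- component and is redirected alike, or keeps this same representative.
    here′ rewrite ≟Exp-complete {u = rep L (head t)} {rep L (head t)} (λ _ → refl)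
      with rep L (tail t) ≟Exp rep L (head t)
    ... | true  = λ _ → refl
    ... | false = λ _ → refl

  ends : List Term → List (Exp n)
  ends []      = []
  ends (t ∷ L) = head t ∷ tail t ∷ ends L

  ends-cover : ∀ L → All (λ t → Any (head t ≐_) (ends L) × Any (tail t ≐_) (ends L)) L
  ends-cover []      = []
  ends-cover (t ∷ L) = (here (λ _ → refl) , there (here (λ _ → refl)))
                     ∷ All.map (λ (h , k) → there (there h) , there (there k)) (ends-cover L)

  module _ (σ : Permutation′ n) where

    search : ∀ (b : Exp n → Bool) α S →
      (∃[ β ] (b β ≡ true × RevLexGt σ α β)) ⊎
      All (λ x → b x ≡ true → x ≐ α ⊎ RevLexGt σ x α) S
    search b α []      = inj₂ []
    search b α (s ∷ S) with search b α S | b s in eq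
    ... | inj₁ found | _     = inj₁ found
    ... | inj₂ all   | false = inj₂ ((λ e → contradiction (trans (sym eq) e) λ ()) ∷ all)
    ... | inj₂ all   | true with RevLexGt-compare σ α s
    ...   | inj₁ gt        = inj₁ (s , eq , gt)
    ...   | inj₂ (inj₁ e)  = inj₂ ((λ _ → inj₁ (sym ∘ e)) ∷ all)
    ...   | inj₂ (inj₂ lt) = inj₂ ((λ _ → inj₂ lt) ∷ all)

    -- If α were the least monomial of its component, the coefficients over that component,
    -- which sum to zero, would all vanish except the one at α.
    leading⇒binomial : ∀ {α} → LeadingMonomial A σ α → ∃[ β ] (SameFiber A α β × RevLexGt σ α β)
    leading⇒binomial {α} (L , α≉0 , above) with search b α (ends L)
      where
      b : Exp n → Bool
      b x = rep L x ≟Exp rep L α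
    ... | inj₁ (β , e , gt) = β , (λ ρ → trans (rep-fiber L α ρ)
                                (trans (sym (·-cong A (≟Exp-sound _ _ e) ρ)) (sym (rep-fiber L β ρ)))) , gt
    ... | inj₂ all = contradiction coeff≈0 α≉0
      where
      b b′ : Exp n → Bool
      b x = rep L x ≟Exp rep L α
      b′ x = b x ∧ not (x ≟Exp α)
      resp : Respects≐ b
      resp e = ≟Exp-congˡ (rep L α) (rep-cong L e)
      -- Every other selected monomial lies above α, where the coefficients of an element led by α
      -- vanish.
      away : ∀ {x} → (b x ≡ true → x ≐ α ⊎ RevLexGt σ x α) → b′ x ≡ true → coeff L x ≈ 0#
      away {x} f e with b x | x ≟Exp α in eq
      away {x} f () | false | _
      away {x} f () | true  | true
      away {x} f e  | true  | false with f refl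
      ... | inj₁ x≐α = contradiction (trans (sym eq) (≟Exp-complete x≐α)) λ ()
      ... | inj₂ gt  = above x gt
      coeff≈0 : coeff L α ≈ 0#
      coeff≈0 = begin
        coeff L α                                 ≈⟨ coeff≈Φ L α ⟩
        Φ (_≟Exp α) L                             ≈⟨ Φ-cong L (∧-≟Exp-true resp (≟Exp-complete (λ _ → refl))) ⟨
        Φ (λ x → b x ∧ (x ≟Exp α)) L              ≈⟨ +ᴷ-identityʳ _ ⟨
        Φ (λ x → b x ∧ (x ≟Exp α)) L +ᴷ 0#
          ≈⟨ +ᴷ-cong ≈-refl (Φ-vanish (ends L) L
               (λ e → cong₂ (λ p q → p ∧ not q) (resp e) (≟Exp-congˡ α e))
               (All.map (λ (h , t) → (λ _ → h) , (λ _ → t)) (ends-cover L))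
               (All.map (λ {x} → away {x}) all)) ⟨
        Φ (λ x → b x ∧ (x ≟Exp α)) L +ᴷ Φ b′ L    ≈⟨ Φ-split b (_≟Exp α) L ⟨
        -- The component of α contains both monomials of a term or neither.
        Φ b L                                     ≈⟨ Φ-balanced (All.map (λ e → ≟Exp-congˡ (rep L α) e) (rep-edges L)) ⟩
        0#                                        ∎

    binomial⇒leading : ∀ {α β} → SameFiber A α β → RevLexGt σ α β → LeadingMonomial A σ α
    binomial⇒leading {α} {β} fib gt = t ∷ [] , nonzero , above
      where
      t : Term
      -- With `w` zero, `head t` and `tail t` compute to α and β, which is the form that the
      -- rewrites below match.
      t = record { coef = 1# ; w = λ _ → 0 ; u = α ; v = β ; fib = fib }
      nonzero : ¬ (coeff (t ∷ []) α ≈ 0#)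
      nonzero z rewrite ≟Exp-complete {u = α} {α} (λ _ → refl)
                      | ≟Exp-false {u = β} {α} (λ e → RevLexGt-irrefl σ (sym ∘ e) gt) =
        0≉1 (≈-trans (≈-sym z) (≈-trans (+ᴷ-identityʳ _) (≈-trans (+ᴷ-cong ≈-refl ε⁻¹≈ε) (+ᴷ-identityʳ 1#))))
      above : ∀ γ → RevLexGt σ γ α → coeff (t ∷ []) γ ≈ 0#
      above γ γ>α rewrite ≟Exp-false {u = α} {γ} (λ e → RevLexGt-irrefl σ (sym ∘ e) γ>α)
                        | ≟Exp-false {u = β} {γ} (λ e → RevLexGt-irrefl σ (sym ∘ e) (RevLexGt-trans σ γ>α gt)) =
        ≈-trans (+ᴷ-identityʳ _) (-‿inverseʳ 0#)

-- Slicing the columns along a vertex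

δ-refl : ∀ {p} (a : Fin p) → δ a a ≡ 1
δ-refl a with a ≟ a
... | yes _ = refl
... | no ne = contradiction refl ne

δ-≢ : ∀ {p} {a c : Fin p} → a ≢ c → δ a c ≡ 0
δ-≢ {a = a} {c} ne with a ≟ c
... | yes e = contradiction e ne
... | no _  = refl

-- The tie-breaking half of `RevLexGt`. It is kept apart from the degrees because it passes between
-- an exponent and its slices, while equality of degrees is supplied by homogeneity.
Beats : ∀ {n} → Permutation′ n → Exp n → Exp n → Set
Beats σ u v = ∃[ k ] (u (σ ⟨$⟩ʳ k) < v (σ ⟨$⟩ʳ k) ×
                      (∀ l → k <ᶠ l → u (σ ⟨$⟩ʳ l) ≡ v (σ ⟨$⟩ʳ l)))

RevLexGt⇒Beats : ∀ {n} {σ : Permutation′ n} {u v} → deg u ≡ deg v → RevLexGt σ u v → Beats σ u v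
RevLexGt⇒Beats e (inj₁ lt)       = contradiction lt (<-irrefl (sym e))
RevLexGt⇒Beats e (inj₂ (_ , bt)) = bt

module Slices {c ℓ} (K : Field c ℓ) {R R′ : Set} {p n N : ℕ}
  (A : Matrix R N) (B : Matrix R′ n) (π : Permutation (p * n) N)
  (a b : Fin p) (a≢b : a ≢ b) (a-max : ∀ (c : Fin p) → toℕ c ≤ toℕ a) where

  open Toric K

  slice : Fin p → Exp N → Exp n
  slice c u k = u (π ⟨$⟩ʳ combine c k)

  place : Exp n → Exp n → Exp N
  place u v x = at (remQuot {p} n (π ⟨$⟩ˡ x))
    where
    at : Fin p × Fin n → ℕ
    at (c , k) = δ a c * u k + δ b c * v k

  slice-place : ∀ u v c k → slice c (place u v) k ≡ δ a c * u k + δ b c * v k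
  slice-place u v c k = cong (λ q → δ a (proj₁ q) * u (proj₂ q) + δ b (proj₁ q) * v (proj₂ q))
    (trans (cong (remQuot {p} n) (inverseˡ π)) (remQuot-combine c k))

  slice-place-a : ∀ u v → slice a (place u v) ≐ u
  slice-place-a u v k rewrite slice-place u v a k | δ-refl a | δ-≢ (a≢b ∘ sym) =
    trans (+-identityʳ _) (+-identityʳ _)

  slice-place-b : ∀ u v → slice b (place u v) ≐ v
  slice-place-b u v k rewrite slice-place u v b k | δ-refl b | δ-≢ a≢b = +-identityʳ _

  slice-place-other : ∀ u v {c} → a ≢ c → b ≢ c → ∀ k → slice c (place u v) k ≡ 0
  slice-place-other u v {c} a≢c b≢c k rewrite slice-place u v c k | δ-≢ a≢c | δ-≢ b≢c = refl

  module _ (σ : Permutation′ n) where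

    private
      size : p * n ≡ N
      size = ↔⇒≡ π

      within : Permutation′ n → Fin (p * n) → Fin (p * n)
      within τ x = at (remQuot {p} n x)
        where
        at : Fin p × Fin n → Fin (p * n)
        at (c , k) = combine c (τ ⟨$⟩ʳ k)

      within-combine : ∀ τ c k → within τ (combine c k) ≡ combine c (τ ⟨$⟩ʳ k)
      within-combine τ c k = cong (λ q → combine (proj₁ q) (τ ⟨$⟩ʳ proj₂ q)) (remQuot-combine {p} c k)

      within-within : ∀ τ τ′ → (∀ k → τ ⟨$⟩ʳ (τ′ ⟨$⟩ʳ k) ≡ k) → ∀ x → within τ (within τ′ x) ≡ x
      within-within τ τ′ e x with combine-surjective {p} {n} x
      ... | c , k , refl = trans (cong (within τ) (within-combine τ′ c k))
                             (trans (within-combine τ c _) (cong (combine c) (e k)))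

      blocks : Permutation′ (p * n)
      blocks = Perm.permutation (within σ) (within (Perm.flip σ))
        (within-within σ (Perm.flip σ) (λ _ → inverseʳ σ)) (within-within (Perm.flip σ) σ (λ _ → inverseˡ σ))

    -- Orders each slice by σ; variables in the slice of a come last, so they are the cheapest.
    σ′ : Permutation′ N
    σ′ = Perm.cast-id (sym size) ∘ₚ blocks ∘ₚ π

    private
      -- The rank under `σ′` of the variable of slice `c` that has rank `k` under σ; see `σ′-pos`.
      pos : Fin p → Fin n → Fin N
      pos c k = cast size (combine c k)

      toℕ-pos : ∀ c k → toℕ (pos c k) ≡ n * toℕ c + toℕ k
      toℕ-pos c k = trans (toℕ-cast size _) (toℕ-combine c k)

      pos-surjective : ∀ l → ∃₂ λ c k → l ≡ pos c k
      pos-surjective l with combine-surjective {p} {n} (cast (sym size) l)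
      ... | c , k , e = c , k , toℕ-injective (trans (sym (toℕ-cast (sym size) l))
                                  (trans (cong toℕ (sym e)) (sym (toℕ-cast size _))))

      σ′-pos : ∀ c k → σ′ ⟨$⟩ʳ pos c k ≡ π ⟨$⟩ʳ combine c (σ ⟨$⟩ʳ k)
      σ′-pos c k = cong (π ⟨$⟩ʳ_) (trans (cong (within σ) uncast) (within-combine σ c k))
        where
        uncast : cast (sym size) (pos c k) ≡ combine c k
        uncast = toℕ-injective (trans (toℕ-cast (sym size) (pos c k)) (toℕ-cast size _))

      pos-mono : ∀ c {k l} → k <ᶠ l → pos c k <ᶠ pos c l
      pos-mono c {k} {l} lt rewrite toℕ-pos c k | toℕ-pos c l = +-monoʳ-< (n * toℕ c) lt

      -- Slices occupy consecutive blocks of ranks and `a-max` makes the block of `a` the last, so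
      -- only ranks of that block can follow.
      above-a : ∀ {k c l} → pos a k <ᶠ pos c l → a ≡ c × k <ᶠ l
      above-a {k} {c} {l} lt with <-cmp (toℕ c) (toℕ a)
      ... | tri> _ _ a<c = contradiction (a-max c) (<⇒≱ a<c)
      ... | tri< c<a _ _ = contradiction lt (<-asym (subst₂ _<_ (sym (toℕ-cast size _)) (sym (toℕ-cast size _))
                                                       (combine-monoˡ-< l k c<a)))
      ... | tri≈ _ e _ with toℕ-injective e
      ...   | refl rewrite toℕ-pos c k | toℕ-pos c l = refl , +-cancelˡ-< (n * toℕ c) _ _ lt

    -- The last difference within slice `a` is the last one overall, whatever slice `b` carries.
    place-Beats : ∀ u v → Beats σ u v → Beats σ′ (place u v) (place v u)
    place-Beats u v (k , lt , above) = pos a k , lt′ , above′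
      where
      at-a : ∀ u v k → place u v (σ′ ⟨$⟩ʳ pos a k) ≡ u (σ ⟨$⟩ʳ k)
      at-a u v k = trans (cong (place u v) (σ′-pos a k)) (slice-place-a u v (σ ⟨$⟩ʳ k))
      lt′ : place u v (σ′ ⟨$⟩ʳ pos a k) < place v u (σ′ ⟨$⟩ʳ pos a k)
      lt′ = subst₂ _<_ (sym (at-a u v k)) (sym (at-a v u k)) lt
      above′ : ∀ l → pos a k <ᶠ l → place u v (σ′ ⟨$⟩ʳ l) ≡ place v u (σ′ ⟨$⟩ʳ l)
      above′ l h with pos-surjective l
      ... | c , j , refl with above-a h
      ...   | refl , k<j = trans (at-a u v j) (trans (above j k<j) (sym (at-a v u j)))

    -- Since `pos c` is increasing, the variable that decides between `s` and `t` also decides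
    -- within its own slice.
    slice-Beats : ∀ s t → Beats σ′ s t → ∃[ c ] Beats σ (slice c s) (slice c t)
    slice-Beats s t (l , lt , above) with pos-surjective l
    ... | c , k , refl = c , k , subst (λ x → s x < t x) (σ′-pos c k) lt ,
                         λ j k<j → subst (λ x → s x ≡ t x) (σ′-pos c j) (above (pos c j) (pos-mono c k<j))

    -- The interface to hierarchical models: fibers of `A` restrict to fibers of `B` on every slice,
    -- and exchanging two members of a fiber of `B` between slices `a` and `b` stays in a fiber of
    -- `A`.
    module _ (homA : Homogeneous A) (homB : Homogeneous B) (sqfA : SquarefreeInitial A σ′)
      (slice-fiber : ∀ {s t} → SameFiber A s t → ∀ c → SameFiber B (slice c s) (slice c t))
      (place-fiber : ∀ {u v} → SameFiber B u v → SameFiber A (place u v) (place v u)) where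

      private
        module IA = Initial K A
        module IB = Initial K B

        SquarefreeDivisor : Exp n → Set _
        SquarefreeDivisor γ = ∃[ s ] (Squarefree s × InInitial B σ s × s ≼ γ)

        value-β : ℕ → Exp n → ℕ
        value-β D β = value (suc D) (β ∘ (σ ⟨$⟩ʳ_))

        digits : ∀ {D β} → D ≡ deg β → ∀ i → (β ∘ (σ ⟨$⟩ʳ_)) i < suc D
        digits {β = β} refl i = s≤s (term≤sumFin n β (σ ⟨$⟩ʳ i))

      -- Terminates because replacing β increases value-β, which is bounded as deg β = deg α.
      descend : ∀ fuel {α β} → SameFiber B α β → Beats σ α β →
                suc (deg α) ^ n ≤ value-β (deg α) β + fuel → SquarefreeDivisor α
      descend zero {α} {β} fib bt bound =
        contradiction (value-bound (suc (deg α)) _ (digits {β = β} (homB _ _ fib)))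
                      (λ lt → <⇒≱ lt (subst (_ ≤_) (+-identityʳ _) bound))
      descend (suc fuel) {α} {β} fib bt bound
        with sqfA (place α β) (place α β ,
               IA.binomial⇒leading σ′ (place-fiber fib)
                 (inj₂ (homA _ _ (place-fiber fib) , place-Beats α β bt)) , λ _ → ≤-refl)
      -- The squarefree `s₀` need only be a multiple of a leading monomial `s`; as a divisor of
      -- `s₀`, `s` is squarefree too, and it is `s` that yields a binomial.
      ... | s₀ , sqf , (s , lead , s≼s₀) , s₀≼U
        with IA.leading⇒binomial σ′ lead
      ... | t , fib-st , s>t
        with slice-Beats s t (RevLexGt⇒Beats {σ = σ′} (homA _ _ fib-st) s>t)
      ... | c , bt-c with a ≟ c | b ≟ c
      ... | yes refl | _ =
        slice a s , (λ k → ≤-trans (s≼s₀ _) (sqf _)) ,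
        (slice a s , IB.binomial⇒leading σ (slice-fiber fib-st a)
          (inj₂ (homB _ _ (slice-fiber fib-st a) , bt-c)) , λ _ → ≤-refl) ,
        λ k → subst (slice a s k ≤_) (slice-place-a α β k) (≤-trans (s≼s₀ _) (s₀≼U _))
      ... | no a≢c | no b≢c = contradiction t-positive (λ lt → n≮0 (subst (slice c s k <_) t-zero lt))
        where
        k = σ ⟨$⟩ʳ proj₁ bt-c
        t-positive : slice c s k < slice c t k
        t-positive = proj₁ (proj₂ bt-c)
        s-zero : ∀ k → slice c s k ≡ 0
        s-zero k with slice c s k | subst (slice c s k ≤_) (slice-place-other α β a≢c b≢c k)
                                      (≤-trans (s≼s₀ _) (s₀≼U _))
        ... | .0 | z≤n = refl
        -- `B` is homogeneous, so slice `c` of `t` has the same degree as that of `s`, namely zero.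
        t-zero : slice c t k ≡ 0
        t-zero with slice c t k | ≤-trans (term≤sumFin n (slice c t) k)
                     (≤-reflexive (trans (sym (homB _ _ (slice-fiber fib-st c))) (sumFin-0 n s-zero)))
        ... | .0 | z≤n = refl
      ... | no _ | yes refl = descend fuel fib′ bt′ bound′
        where
        -- Slice `b` of `s` divides β; replacing this factor by slice `b` of `t` gives `β′`, with
        -- cofactor `w`.
        w β′ : Exp n
        w k = β k ∸ slice b s k
        β′  = w ⊕ slice b t
        w⊕s≐β : (w ⊕ slice b s) ≐ β
        w⊕s≐β k = m∸n+n≡m (subst (slice b s k ≤_) (slice-place-b α β k) (≤-trans (s≼s₀ _) (s₀≼U _)))
        fib-ββ′ : SameFiber B β β′
        fib-ββ′ = SameFiber-trans B (SameFiber-sym B (·-cong B w⊕s≐β)) (SameFiber-⊕ B w (slice-fiber fib-st b))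
        fib′ : SameFiber B α β′
        fib′ = SameFiber-trans B fib fib-ββ′
        k₀ = proj₁ bt-c
        lt₀ : β (σ ⟨$⟩ʳ k₀) < β′ (σ ⟨$⟩ʳ k₀)
        lt₀ = subst (_< β′ (σ ⟨$⟩ʳ k₀)) (w⊕s≐β _) (+-monoʳ-< (w (σ ⟨$⟩ʳ k₀)) (proj₁ (proj₂ bt-c)))
        above₀ : ∀ l → k₀ <ᶠ l → β (σ ⟨$⟩ʳ l) ≡ β′ (σ ⟨$⟩ʳ l)
        above₀ l h = trans (sym (w⊕s≐β _)) (cong (w (σ ⟨$⟩ʳ l) +_) (proj₂ (proj₂ bt-c) l h))
        bt′ : Beats σ α β′
        bt′ = RevLexGt⇒Beats {σ = σ} (homB _ _ fib′)
                (RevLexGt-trans σ (inj₂ (homB _ _ fib , bt)) (inj₂ (homB _ _ fib-ββ′ , k₀ , lt₀ , above₀)))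
        -- Of two monomials of equal degree the smaller has the larger exponent at the deciding
        -- variable, hence the larger value.
        value-up : value-β (deg α) β < value-β (deg α) β′
        value-up = value-< (suc (deg α)) _ _ (digits {β = β} (homB _ _ fib)) k₀ lt₀ above₀
        bound′ : suc (deg α) ^ n ≤ value-β (deg α) β′ + fuel
        bound′ = ≤-trans bound (≤-trans (≤-reflexive (+-suc _ fuel)) (+-monoˡ-≤ fuel value-up))

      squarefree-initial : SquarefreeInitial B σ
      squarefree-initial γ (α , lead , α≼γ) with IB.leading⇒binomial σ lead
      ... | β , fib , gt
        -- This amount of fuel alone meets the bound, whatever the value of β.
        with descend (suc (deg α) ^ n) fib (RevLexGt⇒Beats {σ = σ} (homB _ _ fib) gt) (m≤n+m _ _)
      ... | s , sqf , init , s≼α = s , sqf , init , λ i → ≤-trans (s≼α i) (α≼γ i)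

-- Marginals and hierarchical models

Tuple : ∀ {m} → (Fin m → ℕ) → Set
Tuple d = ∀ j → Fin (d j)

encodeCol : ∀ m (d : Fin m → ℕ) → Tuple d → Fin (prodFin m d)
encodeCol zero    d f = zero
encodeCol (suc m) d f = combine (f zero) (encodeCol m (d ∘ suc) (f ∘ suc))

decode-encode : ∀ m (d : Fin m → ℕ) f j → decodeCol m d (encodeCol m d f) j ≡ f j
decode-encode (suc m) d f zero =
  cong proj₁ (remQuot-combine (f zero) (encodeCol m (d ∘ suc) (f ∘ suc)))
decode-encode (suc m) d f (suc j) =
  trans (cong (λ q → decodeCol m (d ∘ suc) (proj₂ q) j)
              (remQuot-combine (f zero) (encodeCol m (d ∘ suc) (f ∘ suc))))
        (decode-encode m (d ∘ suc) (f ∘ suc) j)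

encode-cong : ∀ m (d : Fin m → ℕ) {f g : Tuple d} → (∀ j → f j ≡ g j) → encodeCol m d f ≡ encodeCol m d g
encode-cong zero    d e = refl
encode-cong (suc m) d e = cong₂ combine (e zero) (encode-cong m (d ∘ suc) (e ∘ suc))

encode-decode : ∀ m (d : Fin m → ℕ) k → encodeCol m d (decodeCol m d k) ≡ k
encode-decode zero    d zero = refl
encode-decode (suc m) d k =
  trans (cong (combine (proj₁ q)) (encode-decode m (d ∘ suc) (proj₂ q))) (combine-remQuot {d zero} _ k)
  where q = remQuot {d zero} (prodFin m (d ∘ suc)) k

-- Dependent counterpart of `insertAt`, as each coordinate of a tuple has its own type `Fin (d j)`.
insertΠ : ∀ {m} {P : Fin (suc m) → Set} v → P v → (∀ j → P (punchIn v j)) → ∀ j → P j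
insertΠ zero            x f zero    = x
insertΠ zero            x f (suc j) = f j
insertΠ {suc m} (suc v) x f zero    = f zero
insertΠ {suc m} {P} (suc v) x f (suc j) = insertΠ {P = P ∘ suc} v x (f ∘ suc) j

insertΠ-at : ∀ {m} {P : Fin (suc m) → Set} v x f → insertΠ {P = P} v x f v ≡ x
insertΠ-at zero            x f = refl
insertΠ-at {suc m} (suc v) x f = insertΠ-at v x (f ∘ suc)

insertΠ-punchIn : ∀ {m} {P : Fin (suc m) → Set} v x f j → insertΠ {P = P} v x f (punchIn v j) ≡ f j
insertΠ-punchIn zero            x f j       = refl
insertΠ-punchIn {suc m} (suc v) x f zero    = refl
insertΠ-punchIn {suc m} (suc v) x f (suc j) = insertΠ-punchIn v x (f ∘ suc) j

insertΠ-η : ∀ {m} {P : Fin (suc m) → Set} v (g : ∀ j → P j) j → insertΠ {P = P} v (g v) (g ∘ punchIn v) j ≡ g j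
insertΠ-η zero            g zero    = refl
insertΠ-η zero            g (suc j) = refl
insertΠ-η {suc m} (suc v) g zero    = refl
insertΠ-η {suc m} (suc v) g (suc j) = insertΠ-η v (g ∘ suc) j

insertΠ-cong : ∀ {m} {P : Fin (suc m) → Set} v {x y : P v} {f g : ∀ j → P (punchIn v j)} →
               x ≡ y → (∀ j → f j ≡ g j) → ∀ j → insertΠ {P = P} v x f j ≡ insertΠ {P = P} v y g j
insertΠ-cong zero            p e zero    = p
insertΠ-cong zero            p e (suc j) = e j
insertΠ-cong {suc m} (suc v) p e zero    = e zero
insertΠ-cong {suc m} (suc v) p e (suc j) = insertΠ-cong v p (e ∘ suc) j

allFin-sound : ∀ m {f : Fin m → Bool} → allFin m f ≡ true → ∀ j → f j ≡ true
allFin-sound (suc m) {f} e j with f zero in eq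
allFin-sound (suc m) e zero    | true = eq
allFin-sound (suc m) e (suc j) | true = allFin-sound m e j
allFin-sound (suc m) () j      | false

allFin-complete : ∀ m {f : Fin m → Bool} → (∀ j → f j ≡ true) → allFin m f ≡ true
allFin-complete zero    e = refl
allFin-complete (suc m) e rewrite e zero = allFin-complete m (e ∘ suc)

allFin-cong : ∀ m {f g : Fin m → Bool} → (∀ j → f j ≡ g j) → allFin m f ≡ allFin m g
allFin-cong zero    e = refl
allFin-cong (suc m) e = cong₂ _∧_ (e zero) (allFin-cong m (e ∘ suc))

allFin-punchIn : ∀ m (f : Fin (suc m) → Bool) v → allFin (suc m) f ≡ f v ∧ allFin m (f ∘ punchIn v)
allFin-punchIn m       f zero    = refl
allFin-punchIn (suc m) f (suc v) = begin
  f zero ∧ allFin (suc m) (f ∘ suc)           ≡⟨ cong (f zero ∧_) (allFin-punchIn m (f ∘ suc) v) ⟩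
  f zero ∧ (f (suc v) ∧ rest)                 ≡⟨ ∧-assoc (f zero) _ _ ⟨
  (f zero ∧ f (suc v)) ∧ rest                 ≡⟨ cong (_∧ rest) (∧-comm (f zero) _) ⟩
  (f (suc v) ∧ f zero) ∧ rest                 ≡⟨ ∧-assoc (f (suc v)) _ _ ⟩
  f (suc v) ∧ (f zero ∧ rest)                 ∎
  where
  open ≡-Reasoning
  rest = allFin m (f ∘ suc ∘ punchIn v)

ind-∧ : ∀ p q → ind (p ∧ q) ≡ ind p * ind q
ind-∧ false q = refl
ind-∧ true  q = sym (+-identityʳ (ind q))

agrees : ∀ {m} (d : Fin m → ℕ) → Subset m → Tuple d → Tuple d → Fin m → Bool
agrees d F i i′ j = if lookup F j then ⌊ i j ≟ i′ j ⌋ else true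

agreesOn : ∀ {m} (d : Fin m → ℕ) → Subset m → Tuple d → Tuple d → ℕ
agreesOn {m} d F i i′ = ind (allFin m (agrees d F i i′))

-- Entries of the F-marginal are indexed by full tuples i rather than by elements of
-- ∏_{j∈F} [d_j], which avoids the dependence of the row type on F.
marginal : ∀ {m} (d : Fin m → ℕ) → Subset m → Tuple d → Exp (prodFin m d) → ℕ
marginal {m} d F i u = sumFin (prodFin m d) (λ k → agreesOn d F i (decodeCol m d k) * u k)

SameMarginals : ∀ {m} (d : Fin m → ℕ) → Subset m → Exp (prodFin m d) → Exp (prodFin m d) → Set
SameMarginals d F u w = ∀ i → marginal d F i u ≡ marginal d F i w

restrict : ∀ {m} (d : Fin m → ℕ) F → Tuple d → (j : Fin m) → Coord d F j
restrict d F i j with lookup F j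
... | inside  = i j
... | outside = tt

-- Agreement on `F` ignores the coordinates outside `F`, so any base tuple may fill them in.
extend : ∀ {m} (d : Fin m → ℕ) F → Tuple d → ((j : Fin m) → Coord d F j) → Tuple d
extend d F i₀ e j with lookup F j | e j
... | inside  | x = x
... | outside | _ = i₀ j

agreeAt-restrict : ∀ {m} (d : Fin m → ℕ) F i i′ j → agreeAt d F (restrict d F i) i′ j ≡ agrees d F i i′ j
agreeAt-restrict d F i i′ j with lookup F j
... | inside  = refl
... | outside = refl

agreeAt-extend : ∀ {m} (d : Fin m → ℕ) F i₀ e i′ j → agreeAt d F e i′ j ≡ agrees d F (extend d F i₀ e) i′ j
agreeAt-extend d F i₀ e i′ j with lookup F j | e j
... | inside  | x = refl
... | outside | _ = refl

SameFiber⇒SameMarginals : ∀ {m} (C : Complex m) d {u w} → SameFiber A[ C , d ] u w →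
                          ∀ {F} → IsFacet C F → SameMarginals d F u w
SameFiber⇒SameMarginals {m} C d {u} {w} fib {F} facet i =
  trans (sym (entry u)) (trans (fib (F , facet , restrict d F i)) (entry w))
  where
  entry : ∀ u → (A[ C , d ] · u) (F , facet , restrict d F i) ≡ marginal d F i u
  entry u = sumFin-cong _ λ k → cong (λ b → ind b * u k)
    (allFin-cong m (agreeAt-restrict d F i (decodeCol m d k)))

SameMarginals⇒SameFiber : ∀ {m} (C : Complex m) d → Tuple d → ∀ {u w} →
                          (∀ {F} → IsFacet C F → SameMarginals d F u w) → SameFiber A[ C , d ] u w
SameMarginals⇒SameFiber {m} C d i₀ {u} {w} same (F , facet , e) =
  trans (entry u) (trans (same facet (extend d F i₀ e)) (sym (entry w)))
  where
  entry : ∀ u → (A[ C , d ] · u) (F , facet , e) ≡ marginal d F (extend d F i₀ e) u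
  entry u = sumFin-cong _ λ k → cong (λ b → ind b * u k)
    (allFin-cong m (agreeAt-extend d F i₀ e (decodeCol m d k)))

agreesOn-congˡ : ∀ {m} (d : Fin m → ℕ) F {i i₁} i′ → (∀ j → i j ≡ i₁ j) → agreesOn d F i i′ ≡ agreesOn d F i₁ i′
agreesOn-congˡ {m} d F i′ e =
  cong ind (allFin-cong m λ j → cong (λ x → if lookup F j then ⌊ x ≟ i′ j ⌋ else true) (e j))

marginal-congˡ : ∀ {m} (d : Fin m → ℕ) F {i i′} u → (∀ j → i j ≡ i′ j) → marginal d F i u ≡ marginal d F i′ u
marginal-congˡ d F u e = sumFin-cong _ λ k → cong (_* u k) (agreesOn-congˡ d F _ e)

marginal-congʳ : ∀ {m} (d : Fin m → ℕ) F i {u w} → u ≐ w → marginal d F i u ≡ marginal d F i w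
marginal-congʳ d F i e = sumFin-cong _ λ k → cong (agreesOn d F i _ *_) (e k)

marginal-linear : ∀ {m} (d : Fin m → ℕ) F i x y u w →
  marginal d F i (λ k → x * u k + y * w k) ≡ x * marginal d F i u + y * marginal d F i w
marginal-linear {m} d F i x y u w = begin
  sumFin _ (λ k → g k * (x * u k + y * w k))
    ≡⟨ sumFin-cong _ (λ k → trans (*-distribˡ-+ (g k) _ _) (cong₂ _+_ (swap (g k) x (u k)) (swap (g k) y (w k)))) ⟩
  sumFin _ (λ k → x * (g k * u k) + y * (g k * w k))
    ≡⟨ sumFin-+ _ (λ k → x * (g k * u k)) (λ k → y * (g k * w k)) ⟩
  sumFin _ (λ k → x * (g k * u k)) + sumFin _ (λ k → y * (g k * w k))
    ≡⟨ cong₂ _+_ (sumFin-*ˡ _ x (λ k → g k * u k)) (sumFin-*ˡ _ y (λ k → g k * w k)) ⟩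
  x * marginal d F i u + y * marginal d F i w ∎
  where
  open ≡-Reasoning
  g : Fin _ → ℕ
  g k = agreesOn d F i (decodeCol m d k)
  swap : ∀ a b c → a * (b * c) ≡ b * (a * c)
  swap a b c = trans (sym (*-assoc a b c)) (trans (cong (_* c) (*-comm a b)) (*-assoc b a c))

-- Each column agrees on F with exactly one column that equals i₀ outside F, so the degree is a
-- sum of entries of the F-marginal.
SameMarginals⇒deg≡ : ∀ {m} (d : Fin m → ℕ) F → Tuple d → ∀ {u w} → SameMarginals d F u w → deg u ≡ deg w
SameMarginals⇒deg≡ {m} d F i₀ {u} {w} same =
  trans (deg-by-class u) (trans (sumFin-cong N class≡) (sym (deg-by-class w)))
  where
  N = prodFin m d
  dec = decodeCol m d
  pick : Tuple d → Tuple d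
  pick i j = if lookup F j then i j else i₀ j
  mask : Fin N → Fin N
  mask k = encodeCol m d (pick (dec k))
  class : Exp N → Fin N → ℕ
  class u k = sumFin N (λ i → δ (mask i) k * u i)
  deg-by-class : ∀ u → deg u ≡ sumFin N (class u)
  deg-by-class u = trans (sumFin-cong N (λ i → sym (sumFin-δ N (mask i) (λ _ → u i)))) (sumFin-swap N N _)
  mask-agrees : ∀ i j → lookup F j ≡ true → dec (mask i) j ≡ dec i j
  mask-agrees i j e = trans (decode-encode m d _ j) (cong (λ b → if b then dec i j else i₀ j) e)
  agree⇒mask≡ : ∀ {k i} → (∀ j → lookup F j ≡ true → dec k j ≡ dec i j) → mask k ≡ mask i
  agree⇒mask≡ {k} {i} e = encode-cong m d pick≡
    where
    pick≡ : ∀ j → pick (dec k) j ≡ pick (dec i) j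
    pick≡ j with lookup F j in eq
    ... | true  = e j eq
    ... | false = refl
  agrees⇒ : ∀ {k i} → allFin m (agrees d F (dec k) (dec i)) ≡ true → ∀ j → lookup F j ≡ true → dec k j ≡ dec i j
  agrees⇒ {k} {i} e j eq with allFin-sound m e j
  ... | e′ rewrite eq with dec k j ≟ dec i j
  ...   | yes p = p
  agrees⇒ e j eq | () | no _
  ⇒agrees : ∀ {k i} → (∀ j → lookup F j ≡ true → dec k j ≡ dec i j) → allFin m (agrees d F (dec k) (dec i)) ≡ true
  ⇒agrees {k} {i} e = allFin-complete m at
    where
    at : ∀ j → agrees d F (dec k) (dec i) j ≡ true
    at j with lookup F j in eq
    ... | false = refl
    ... | true with dec k j ≟ dec i j
    ...   | yes _ = refl
    ...   | no ne = contradiction (e j eq) ne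
  mask-idem : ∀ i → mask (mask i) ≡ mask i
  mask-idem i = agree⇒mask≡ (mask-agrees i)
  δ≡agreesOn : ∀ {k} → mask k ≡ k → ∀ i → δ (mask i) k ≡ agreesOn d F (dec k) (dec i)
  δ≡agreesOn {k} fixed i with mask i ≟ k | allFin m (agrees d F (dec k) (dec i)) in eq
  ... | yes _ | true  = refl
  ... | no _  | false = refl
  ... | no ne | true  = contradiction (trans (sym (agree⇒mask≡ {k} {i} (agrees⇒ eq))) fixed) ne
  ... | yes refl | false = contradiction (trans (sym eq) (⇒agrees (mask-agrees i))) λ ()
  -- If `k` is its own mask, its class consists of the columns agreeing with it on `F` and sums to
  -- an entry of the marginal; otherwise the class is empty, masks being idempotent.
  class≡ : ∀ k → class u k ≡ class w k
  class≡ k with mask k ≟ k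
  ... | yes fixed = trans (as-marginal u) (trans (same (dec k)) (sym (as-marginal w)))
    where
    as-marginal : ∀ u → class u k ≡ marginal d F (dec k) u
    as-marginal u = sumFin-cong N λ i → cong (_* u i) (δ≡agreesOn fixed i)
  ... | no moved = trans (vanishes u) (sym (vanishes w))
    where
    vanishes : ∀ u → class u k ≡ 0
    vanishes u = sumFin-0 N λ i → cong (_* u i) (δ-≢ {a = mask i} {k} λ { refl → moved (mask-idem i) })

-- Membership in C is not assumed decidable, so facets exist only up to double negation.
face⇒¬¬facet : ∀ {m} (C : Complex m) {F} → C F → ¬ ¬ (∃ (IsFacet C))
face⇒¬¬facet C {F} CF none = go CF (⊃-wellFounded F)
  where
  go : ∀ {F} → C F → Acc _⊃_ F → Empty.⊥
  go {F} CF (acc rec) = none (F , CF , maximal)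
    where
    maximal : ∀ G → C G → F ⊆ G → G ⊆ F
    maximal G CG F⊆G {x} x∈G with x ∈? F
    ... | yes x∈F = x∈F
    ... | no x∉F  = Empty.⊥-elim (go CG (rec (F⊆G , x , x∈G , x∉F)))

-- One facet determines the degree, and a facet up to double negation suffices because equality of
-- natural numbers is decidable, hence stable.
homogeneous : ∀ {m} (C : Complex m) d → Tuple d → ∀ {F} → C F → Homogeneous A[ C , d ]
homogeneous C d i₀ CF u w fib = decidable-stable (deg u ℕ.≟ deg w) λ ne →
  face⇒¬¬facet C CF λ (F , facet) → ne (SameMarginals⇒deg≡ d F i₀ (SameFiber⇒SameMarginals C d fib facet))

-- Facets of the link

insertAt-⊥ : ∀ {m} (v : Fin (suc m)) → insertAt ⊥ v inside ≡ ⁅ v ⁆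
insertAt-⊥ zero            = refl
insertAt-⊥ {suc m} (suc v) = cong (outside ∷_) (insertAt-⊥ v)

insertAt-⊆ : ∀ {m} {G H : Subset m} {s t} v → insertAt G v s ⊆ insertAt H v t → G ⊆ H
insertAt-⊆ {G = G} {H} {s} {t} v sub {x} x∈G = lookup⇒[]= x H
  (trans (sym (insertAt-punchIn H v t x))
    ([]=⇒lookup (sub (lookup⇒[]= (punchIn v x) _ (trans (insertAt-punchIn G v s x) ([]=⇒lookup x∈G))))))

⊆-insertAt : ∀ {m} {G H : Subset m} v → G ⊆ H → insertAt G v inside ⊆ insertAt H v inside
⊆-insertAt {G = G} {H} v sub {x} x∈ with v ≟ x
... | yes refl = lookup⇒[]= v _ (insertAt-lookup H v inside)
... | no v≢x   = lookup⇒[]= x _ (subst (λ y → lookup (insertAt H v inside) y ≡ inside) (punchIn-punchOut v≢x)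
    (trans (insertAt-punchIn H v inside y)
      ([]=⇒lookup (sub (lookup⇒[]= y G (trans (sym (insertAt-punchIn G v inside y))
        (trans (cong (lookup (insertAt G v inside)) (punchIn-punchOut v≢x)) ([]=⇒lookup x∈))))))))
  where y = punchOut v≢x

removeAt-inside : ∀ {m} (H : Subset (suc m)) v → lookup H v ≡ inside → insertAt (removeAt H v) v inside ≡ H
removeAt-inside H v e = trans (cong (insertAt (removeAt H v) v) (sym e)) (insertAt-removeAt H v)

-- A face `H` above the extended facet contains `v`, so it comes from the face `removeAt H v` of the
-- link, to which maximality of `G` applies.
facet-insertAt : ∀ {m} (C : Complex (suc m)) v {G} → IsFacet (link C v) G → IsFacet C (insertAt G v inside)
facet-insertAt C v {G} (CG , maxG) = CG , maximal
  where
  maximal : ∀ H → C H → insertAt G v inside ⊆ H → H ⊆ insertAt G v inside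
  maximal H CH sub = subst (_⊆ insertAt G v inside) eq
    (⊆-insertAt v (maxG (removeAt H v) (subst C (sym eq) CH)
      (insertAt-⊆ v (subst (insertAt G v inside ⊆_) (sym eq) sub))))
    where
    eq : insertAt (removeAt H v) v inside ≡ H
    eq = removeAt-inside H v ([]=⇒lookup (sub (lookup⇒[]= v _ (insertAt-lookup G v inside))))

facet-removeAt : ∀ {m} (C : Complex (suc m)) v {G} → IsFacet C (insertAt G v inside) → IsFacet (link C v) G
facet-removeAt C v (CG , maxG) = CG , λ H CH sub → insertAt-⊆ v (maxG _ CH (⊆-insertAt v sub))

-- Columns and marginals of a hierarchical model along a vertex

module Columns {m} (d : Fin (suc m) → ℕ) (v : Fin (suc m)) where

  private
    d′ = deleteEntry d v
    n = prodFin m d′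
    N = prodFin (suc m) d

  join : Fin (d v) × Fin n → Fin N
  join (c , k) = encodeCol (suc m) d (insertΠ v c (decodeCol m d′ k))

  decode-join-v : ∀ c k → decodeCol (suc m) d (join (c , k)) v ≡ c
  decode-join-v c k = trans (decode-encode (suc m) d (insertΠ v c t) v) (insertΠ-at {P = Fin ∘ d} v c t)
    where t = decodeCol m d′ k

  decode-join-punchIn : ∀ c k j → decodeCol (suc m) d (join (c , k)) (punchIn v j) ≡ decodeCol m d′ k j
  decode-join-punchIn c k j = trans 
    (decode-encode (suc m) d (insertΠ v c t) (punchIn v j)) (insertΠ-punchIn {P = Fin ∘ d} v c t j)
    where t = decodeCol m d′ k

  columns : Permutation (d v * n) N
  columns = Perm.permutation to from to-from from-to
    where
    to : Fin (d v * n) → Fin N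
    to z = join (remQuot n z)
    from : Fin N → Fin (d v * n)
    from x = combine (decodeCol (suc m) d x v) (encodeCol m d′ (decodeCol (suc m) d x ∘ punchIn v))
    to-from : ∀ x → to (from x) ≡ x
    to-from x = trans (cong join (remQuot-combine (decodeCol (suc m) d x v) _))
      (trans (encode-cong (suc m) d λ j → trans (insertΠ-cong v refl (decode-encode m d′ _) j)
                                                (insertΠ-η v (decodeCol (suc m) d x) j))
             (encode-decode (suc m) d x))
    from-to : ∀ z → from (to z) ≡ z
    from-to z = trans (cong₂ combine (decode-join-v c k)
                        (trans (encode-cong m d′ (decode-join-punchIn c k)) (encode-decode m d′ k)))
                      (combine-remQuot {d v} n z)
      where
      c = proj₁ (remQuot {d v} n z)
      k = proj₂ (remQuot {d v} n z)

  columns-join : ∀ c k → columns ⟨$⟩ʳ combine c k ≡ join (c , k)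
  columns-join c k = cong join (remQuot-combine c k)

  sliceOf : Fin (d v) → Exp N → Exp n
  sliceOf c u k = u (columns ⟨$⟩ʳ combine c k)

  private
    agrees-v : Subset (suc m) → Tuple d → Fin (d v) → Bool
    agrees-v F i c = if lookup F v then ⌊ i v ≟ c ⌋ else true

  -- The agreement test on `F` factors into a test at `v` and a test on the other coordinates.
  -- Describing `G` by its membership values lets this serve facets with and without `v`.
  marginal-slices : ∀ F G → (∀ j → lookup F (punchIn v j) ≡ lookup G j) → ∀ i u →
    marginal d F i u ≡
    sumFin (d v) (λ c → ind (agrees-v F i c) * marginal d′ G (i ∘ punchIn v) (sliceOf c u))
  marginal-slices F G F~G i u = begin
    marginal d F i u
      ≡⟨ sumFin-permute f columns ⟩
    sumFin (d v * n) (λ z → f (columns ⟨$⟩ʳ z))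
      ≡⟨ sumFin-combine (d v) n _ ⟩
    sumFin (d v) (λ c → sumFin n (λ k → f (columns ⟨$⟩ʳ combine c k)))
      ≡⟨ sumFin-cong (d v) (λ c → trans (sumFin-cong n (split c)) (sumFin-*ˡ n (ind (agrees-v F i c)) _)) ⟩
    sumFin (d v) (λ c → ind (agrees-v F i c) * marginal d′ G (i ∘ punchIn v) (sliceOf c u)) ∎
    where
    open ≡-Reasoning
    f : Fin N → ℕ
    f x = agreesOn d F i (decodeCol (suc m) d x) * u x
    g : Fin n → ℕ
    g k = agreesOn d′ G (i ∘ punchIn v) (decodeCol m d′ k)
    agreesOn-join : ∀ c k → agreesOn d F i (decodeCol (suc m) d (join (c , k))) ≡ ind (agrees-v F i c) * g k
    agreesOn-join c k = trans (cong ind (trans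
        (allFin-punchIn m (agrees d F i (decodeCol (suc m) d (join (c , k)))) v) (cong₂ _∧_
        (cong (agrees-v F i) (decode-join-v c k))
        (allFin-cong m λ j → cong₂ (λ b x → if b then ⌊ i (punchIn v j) ≟ x ⌋ else true)
                               (F~G j) (decode-join-punchIn c k j)))))
      (ind-∧ (agrees-v F i c) _)
    split : ∀ c k → f (columns ⟨$⟩ʳ combine c k) ≡ ind (agrees-v F i c) * (g k * sliceOf c u k)
    split c k = trans (cong (_* sliceOf c u k) (trans (cong (agreesOn d F i ∘ decodeCol (suc m) d) (columns-join c k))
                                                      (agreesOn-join c k)))
                      (*-assoc (ind (agrees-v F i c)) (g k) _)

  -- With `v` in the facet, the test at `v` singles out one slice; without it, as in
  -- `marginal-outside`, all slices are summed.
  marginal-insertAt : ∀ G i u →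
    marginal d (insertAt G v inside) i u ≡ marginal d′ G (i ∘ punchIn v) (sliceOf (i v) u)
  marginal-insertAt G i u = trans (marginal-slices (insertAt G v inside) G (insertAt-punchIn G v inside) i u)
    (trans (sumFin-cong (d v) λ c →
              cong (λ b → ind (if b then ⌊ i v ≟ c ⌋ else true) * marginal d′ G (i ∘ punchIn v) (sliceOf c u))
                   (insertAt-lookup G v inside))
           (sumFin-δ (d v) (i v) _))

  marginal-outside : ∀ F → lookup F v ≡ outside → ∀ i u →
    marginal d F i u ≡ sumFin (d v) (λ c → marginal d′ (removeAt F v) (i ∘ punchIn v) (sliceOf c u))
  marginal-outside F v∉F i u = trans (marginal-slices F (removeAt F v) (λ j → sym (removeAt-punchIn F v j)) i u)
    (sumFin-cong (d v) λ c → trans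
      (cong (λ b → ind (if b then ⌊ i v ≟ c ⌋ else true) * marginal d′ (removeAt F v) (i ∘ punchIn v) (sliceOf c u))
            v∉F)
      (*-identityˡ _))
    where
    removeAt-punchIn : ∀ {m} (F : Subset (suc m)) v j → lookup (removeAt F v) j ≡ lookup F (punchIn v j)
    removeAt-punchIn F v j = trans (sym (insertAt-punchIn (removeAt F v) v (lookup F v) j))
      (cong (λ G → lookup G (punchIn v j)) (insertAt-removeAt F v))

  module _ (C : Complex (suc m)) (i₀ : Tuple d) where

    -- A facet of the link extends by `v` to a facet of `C`, and its marginal at tuples with
    -- `v`-coordinate `c` sees slice `c` alone.
    slice-SameFiber : ∀ {s t} → SameFiber A[ C , d ] s t →
      ∀ c → SameFiber A[ link C v , d′ ] (sliceOf c s) (sliceOf c t)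
    slice-SameFiber {s} {t} fib c = SameMarginals⇒SameFiber (link C v) d′ (i₀ ∘ punchIn v) same
      where
      same : ∀ {G} → IsFacet (link C v) G → SameMarginals d′ G (sliceOf c s) (sliceOf c t)
      same {G} facet i = trans (sym (at-i s))
          (trans (SameFiber⇒SameMarginals C d fib (facet-insertAt C v facet) (insertΠ v c i)) (at-i t))
        where
        at-i : ∀ u → marginal d (insertAt G v inside) (insertΠ v c i) u ≡ marginal d′ G i (sliceOf c u)
        at-i u = trans (marginal-insertAt G (insertΠ v c i) u)
          (trans (marginal-congˡ d′ G _ (insertΠ-punchIn v c i))
                 (cong (λ c → marginal d′ G i (sliceOf c u)) (insertΠ-at v c i)))

    -- A facet avoiding `v` sees only the sum over slices, which the exchange leaves unchanged. A
    -- facet through `v` sees a single slice, where the marginals of `u` and `w` coincide because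
    -- the rest of the facet is a facet of the link.
    swap-SameFiber : ∀ a b {u w : Exp n} {U W : Exp N} →
      (∀ c k → sliceOf c U k ≡ δ a c * u k + δ b c * w k) →
      (∀ c k → sliceOf c W k ≡ δ a c * w k + δ b c * u k) →
      SameFiber A[ link C v , d′ ] u w → SameFiber A[ C , d ] U W
    swap-SameFiber a b {u} {w} {U} {W} hU hW fib = SameMarginals⇒SameFiber C d i₀ same
      where
      expand : ∀ u w U → (∀ c k → sliceOf c U k ≡ δ a c * u k + δ b c * w k) → ∀ G i c →
        marginal d′ G i (sliceOf c U) ≡ δ a c * marginal d′ G i u + δ b c * marginal d′ G i w
      expand u w U h G i c = trans (marginal-congʳ d′ G i (h c)) (marginal-linear d′ G i (δ a c) (δ b c) u w)

      same : ∀ {F} → IsFacet C F → SameMarginals d F U W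
      same {F} facet i with lookup F v in eq
      ... | outside = trans (total u w U hU) (trans (+-comm (marginal d′ G i′ u) _) (sym (total w u W hW)))
        where
        G = removeAt F v
        i′ : Tuple d′
        i′ = i ∘ punchIn v
        total : ∀ u w U → (∀ c k → sliceOf c U k ≡ δ a c * u k + δ b c * w k) →
                marginal d F i U ≡ marginal d′ G i′ u + marginal d′ G i′ w
        total u w U h = trans (marginal-outside F eq i U)
          (trans (sumFin-cong (d v) (expand u w U h G i′))
            (trans (sumFin-+ (d v) _ _) (cong₂ _+_ (sumFin-δ (d v) a _) (sumFin-δ (d v) b _))))
      ... | inside = subst (λ F → marginal d F i U ≡ marginal d F i W) (removeAt-inside F v eq)
        (trans (marginal-insertAt G i U) (trans (expand u w U hU G i′ (i v))
          (trans (cong₂ (λ x y → δ a (i v) * x + δ b (i v) * y) u≡w (sym u≡w))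
            (sym (trans (marginal-insertAt G i W) (expand w u W hW G i′ (i v)))))))
        where
        G = removeAt F v
        i′ : Tuple d′
        i′ = i ∘ punchIn v
        u≡w : marginal d′ G i′ u ≡ marginal d′ G i′ w
        u≡w = SameFiber⇒SameMarginals (link C v) d′ fib
                (facet-removeAt C v (subst (IsFacet C) (sym (removeAt-inside F v eq)) facet)) i′

-- Compressedness of the link

first-last : ∀ {p} → 2 ≤ p → ∃₂ λ (a b : Fin p) → a ≢ b × (∀ (c : Fin p) → toℕ c ≤ toℕ a)
first-last {suc (suc q)} (s≤s (s≤s _)) = fromℕ (suc q) , zero , (λ ()) , ≤fromℕ

theorem6p7 : ∀ {c ℓ} (K : Field c ℓ) (m : ℕ) (C : Complex (suc m)) (d : Fin (suc m) → ℕ) →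
    IsSimplicialComplex C → (∀ j → 2 ≤ d j) →
    Toric.Compressed K A[ C , d ] →
    (v : Fin (suc m)) → IsVertex C v →
    Toric.Compressed K A[ link C v , deleteEntry d v ]
theorem6p7 K m C d _ 2≤d (homC , sqfC) v Cv with first-last (2≤d v)
-- The two slices exist because `d v` is at least 2; `a` is the last level at `v`.
... | a , b , a≢b , a-max = homL , λ σ →
  squarefree-initial σ homC homL (sqfC (σ′ σ)) (slice-SameFiber C i₀)
    (λ {u} {w} → swap-SameFiber C i₀ a b (slice-place u w) (slice-place w u))
  where
  open Columns d v
  open Slices K A[ C , d ] A[ link C v , deleteEntry d v ] columns a b a≢b a-max
  i₀ : Tuple d
  i₀ j = proj₁ (first-last (2≤d j))
  homL : Homogeneous A[ link C v , deleteEntry d v ]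
  -- As `v` is a vertex, the empty set is a face of the link, which provides the face that
  -- homogeneity starts from.
  homL = homogeneous (link C v) (deleteEntry d v) (i₀ ∘ punchIn v) {⊥} (subst C (sym (insertAt-⊥ v)) Cv)
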